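{- Let $M$ be a nonempty compact convex set of width $w$ in $\mathbb{R}^n$ and let $\boldsymbol{x}_1,\dots,\boldsymbol{x}_k$ be points in $M$. Let $S$ be the collection of all planks $P$ in $\mathbb{R}^n$ with both bounding hyperplanes intersecting $M$ and such that the interior of $P$ does not contain any point $\boldsymbol{x}_i$, $1 \leq i \leq k$. For each such plank write $h(P)$ for its width, and define $$H := \sup_{P \in S} h(P).$$ Then $$H \geq \begin{cases} \dfrac{w}{k-n+2} & \text{if } k \geq n, \\[2mm] \dfrac{w}{2} & \text{if } k < n. \end{cases}$$
   Context: The width $w(M)$ of a nonempty convex compact set $M \subset \mathbb{R}^n$ is the smallest distance between two parallel supporting hyperplanes to $M$ (with $M$ lying between them). A plank $P$ in $\mathbb{R}^n$ is a strip of space between two parallel (affine, $(n-1)$-dimensional) hyperplanes, called its bounding hyperplanes; its width $h(P)$ is the distance between them. -}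

module Defs where

open import Algebra.Bundles using (CommutativeRing; Semiring)
open import Algebra.Definitions using (Invertible)
open import Data.Fin.Base using (Fin)
open import Data.List.Base using (List)
open import Data.List.Relation.Unary.Any using (Any)
open import Data.Nat.Base as ℕ using (ℕ; zero; suc)
open import Data.Product.Base using (∃; ∃₂; _×_; _,_; proj₁; proj₂)
open import Data.Sum.Base using (inj₁; inj₂)
open import Data.Vec.Functional using (Vector)
open import Level using (0ℓ)
open import Relation.Binary.Core using (Rel)
open import Relation.Binary.Structures using (IsTotalOrder)
open import Relation.Nullary.Negation using (¬_)
open import Relation.Unary using (Pred; _∈_; _∉_; _⊆_; _≬_; ⋃; Satisfiable)

import Algebra.Definitions.RawSemiring as RawSemiringDefs
import Algebra.Properties.Ring as RingProperties
import Relation.Binary.Construct.NonStrictToStrict as NonStrictToStrict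
import Relation.Binary.Reasoning.Setoid as SetoidReasoning

module Bounds {A : Set} (_≤_ : Rel A 0ℓ) where

  UpperBound LowerBound : Pred A 0ℓ → Pred A 0ℓ
  UpperBound P b = ∀ {x} → x ∈ P → x ≤ b
  LowerBound P b = ∀ {x} → x ∈ P → b ≤ x

  IsSupremum IsInfimum IsMinimum : Pred A 0ℓ → Pred A 0ℓ
  IsSupremum P s = s ∈ UpperBound P × s ∈ LowerBound (UpperBound P)
  IsInfimum  P s = s ∈ LowerBound P × s ∈ UpperBound (LowerBound P)
  IsMinimum  P s = s ∈ P × s ∈ LowerBound P

-- The real numbers, given by the axioms that characterise them up to
-- isomorphism in classical logic.

record CompleteOrderedField : Set₁ where
  infix 4 _≤_
  field
    commutativeRing : CommutativeRing 0ℓ 0ℓ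

  open CommutativeRing commutativeRing public

  field
    _≤_          : Rel Carrier 0ℓ
    isTotalOrder : IsTotalOrder _≈_ _≤_
    0≉1          : ¬ (0# ≈ 1#)
    invertible   : ∀ {x} → ¬ (x ≈ 0#) → Invertible _≈_ 1# _*_ x
    +-monoˡ-≤    : ∀ {x y} z → x ≤ y → x + z ≤ y + z
    *-nonneg     : ∀ {x y} → 0# ≤ x → 0# ≤ y → 0# ≤ x * y

  open Bounds _≤_ public

  field
    supremum : (P : Pred Carrier 0ℓ) → Satisfiable P →
               Satisfiable (UpperBound P) → Satisfiable (IsSupremum P)

  open IsTotalOrder isTotalOrder public using (total; antisym)
    renaming (refl to ≤-refl; reflexive to ≤-reflexive; trans to ≤-trans)

  open NonStrictToStrict _≈_ _≤_ public using (_<_)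

  open RawSemiringDefs (Semiring.rawSemiring semiring) public
    using (sum) renaming (_×_ to _·ℕ_)

module FieldProperties (ℝ : CompleteOrderedField) where

  open CompleteOrderedField ℝ
  open RingProperties ring using (-‿distribˡ-*; -‿distribʳ-*; -‿involutive)

  +-mono-≤ : ∀ {a b c d} → a ≤ b → c ≤ d → a + c ≤ b + d
  +-mono-≤ {a} {b} {c} {d} a≤b c≤d = ≤-trans (+-monoˡ-≤ c a≤b)
    (≤-trans (≤-reflexive (+-comm b c))
      (≤-trans (+-monoˡ-≤ b c≤d) (≤-reflexive (+-comm d b))))

  x≤0⇒0≤-x : ∀ {x} → x ≤ 0# → 0# ≤ - x
  x≤0⇒0≤-x {x} x≤0 = ≤-trans (≤-reflexive (sym (-‿inverseʳ x)))
    (≤-trans (+-monoˡ-≤ (- x) x≤0) (≤-reflexive (+-identityˡ (- x))))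

  x≤y⇒0≤y-x : ∀ {x y} → x ≤ y → 0# ≤ y - x
  x≤y⇒0≤y-x {x} x≤y =
    ≤-trans (≤-reflexive (sym (-‿inverseʳ x))) (+-monoˡ-≤ (- x) x≤y)

  0≤y-x⇒x≤y : ∀ {x y} → 0# ≤ y - x → x ≤ y
  0≤y-x⇒x≤y {x} {y} p = ≤-trans (≤-reflexive (sym (+-identityˡ x)))
    (≤-trans (+-monoˡ-≤ x p) (≤-reflexive
      (trans (+-assoc y (- x) x) (trans (+-congˡ (-‿inverseˡ x)) (+-identityʳ y)))))

  0≤x*x : ∀ x → 0# ≤ x * x
  0≤x*x x with total 0# x
  ... | inj₁ 0≤x = *-nonneg 0≤x 0≤x
  ... | inj₂ x≤0 = ≤-trans (*-nonneg (x≤0⇒0≤-x x≤0) (x≤0⇒0≤-x x≤0))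
                     (≤-reflexive -x*-x≈x*x)
    where
    open SetoidReasoning setoid
    -x*-x≈x*x : - x * - x ≈ x * x
    -x*-x≈x*x = begin
      - x * - x     ≈⟨ -‿distribˡ-* x (- x) ⟨
      - (x * - x)   ≈⟨ -‿cong (-‿distribʳ-* x x) ⟨
      - (- (x * x)) ≈⟨ -‿involutive (x * x) ⟩
      x * x         ∎

  0≤1 : 0# ≤ 1#
  0≤1 = ≤-trans (0≤x*x 1#) (≤-reflexive (*-identityˡ 1#))

  0≤n·1 : ∀ n → 0# ≤ n ·ℕ 1#
  0≤n·1 zero    = ≤-refl
  0≤n·1 (suc n) =
    ≤-trans (≤-reflexive (sym (+-identityˡ 0#))) (+-mono-≤ 0≤1 (0≤n·1 n))

  1+n·1≉0 : ∀ n → ¬ (suc n ·ℕ 1# ≈ 0#)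
  1+n·1≉0 n eq = 0≉1 (antisym 0≤1 (≤-trans 1≤1+n (≤-reflexive eq)))
    where
    1≤1+n : 1# ≤ suc n ·ℕ 1#
    1≤1+n = ≤-trans (≤-reflexive (sym (+-identityʳ 1#)))
              (+-mono-≤ ≤-refl (0≤n·1 n))

  x*x≤s⇒x≤1+s : ∀ {x s} → 0# ≤ s → x * x ≤ s → x ≤ 1# + s
  x*x≤s⇒x≤1+s {x} {s} 0≤s x²≤s with total x 1#
  ... | inj₁ x≤1 =
    ≤-trans (≤-reflexive (sym (+-identityʳ x))) (+-mono-≤ x≤1 0≤s)
  ... | inj₂ 1≤x = ≤-trans x≤x² (≤-trans x²≤s
    (≤-trans (≤-reflexive (sym (+-identityˡ s))) (+-monoˡ-≤ s 0≤1)))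
    where
    0≤x : 0# ≤ x
    0≤x = ≤-trans 0≤1 1≤x
    open SetoidReasoning setoid
    x*[x-1]≈x*x-x : x * (x - 1#) ≈ x * x - x
    x*[x-1]≈x*x-x = begin
      x * (x - 1#)       ≈⟨ distribˡ x x (- 1#) ⟩
      x * x + x * - 1#   ≈⟨ +-congˡ (-‿distribʳ-* x 1#) ⟨
      x * x + - (x * 1#) ≈⟨ +-congˡ (-‿cong (*-identityʳ x)) ⟩
      x * x - x          ∎
    x≤x² : x ≤ x * x
    x≤x² = 0≤y-x⇒x≤y (≤-trans (*-nonneg 0≤x (x≤y⇒0≤y-x 1≤x))
                                (≤-reflexive x*[x-1]≈x*x-x))

  infixl 7 _/_
  _/_ : Carrier → (n : ℕ) → .{{ℕ.NonZero n}} → Carrier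
  x / suc n = x * proj₁ (invertible (1+n·1≉0 n))

module Geometry (ℝ : CompleteOrderedField) where

  open CompleteOrderedField ℝ
  open FieldProperties ℝ

  ℝ^ : ℕ → Set
  ℝ^ n = Vector Carrier n

  -- Sets of points are arbitrary predicates; they are not required to respect
  -- pointwise _≈_, since nothing below depends on it.
  Subset : ℕ → Set₁
  Subset n = Pred (ℝ^ n) 0ℓ

  module _ {n : ℕ} where

    infixl 6 _⊕_ _⊖_
    infixr 7 _⊛_

    _⊕_ _⊖_ : ℝ^ n → ℝ^ n → ℝ^ n
    (x ⊕ y) i = x i + y i
    (x ⊖ y) i = x i - y i

    _⊛_ : Carrier → ℝ^ n → ℝ^ n
    (t ⊛ x) i = t * x i

    IsZero : Pred (ℝ^ n) 0ℓ
    IsZero x = ∀ i → x i ≈ 0#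

  ⟨_,_⟩ : ∀ {n} → ℝ^ n → ℝ^ n → Carrier
  ⟨ x , y ⟩ = sum (λ i → x i * y i)

  0≤⟨x,x⟩ : ∀ {n} (x : ℝ^ n) → 0# ≤ ⟨ x , x ⟩
  0≤⟨x,x⟩ {zero}  x = ≤-refl
  0≤⟨x,x⟩ {suc n} x = ≤-trans (≤-reflexive (sym (+-identityˡ 0#)))
    (+-mono-≤ (0≤x*x (x Fin.zero)) (0≤⟨x,x⟩ (λ i → x (Fin.suc i))))

  -- The square root of a nonnegative s, as the supremum of { t | t² ≤ s }.
  sqrt : (s : Carrier) → 0# ≤ s → Carrier
  sqrt s 0≤s = proj₁ (supremum (λ t → t * t ≤ s)
    (0# , ≤-trans (≤-reflexive (zeroˡ 0#)) 0≤s)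
    (1# + s , x*x≤s⇒x≤1+s 0≤s))

  ‖_‖ : ∀ {n} → ℝ^ n → Carrier
  ‖ x ‖ = sqrt ⟨ x , x ⟩ (0≤⟨x,x⟩ x)

  module _ {n : ℕ} where

    Ball : ℝ^ n → Carrier → Subset n
    Ball x ε y = ‖ y ⊖ x ‖ < ε

    Interior : Subset n → Subset n
    Interior A x = ∃ λ ε → 0# < ε × Ball x ε ⊆ A

    Open : Subset n → Set
    Open A = A ⊆ Interior A

    Compact : Subset n → Set₁
    Compact A = (I : Set) (U : I → Subset n) → (∀ i → Open (U i)) → A ⊆ ⋃ I U →
                ∃ λ (is : List I) → ∀ {x} → x ∈ A → Any (λ i → x ∈ U i) is

    Convex : Subset n → Set
    Convex A = ∀ {x y t} → x ∈ A → y ∈ A → 0# ≤ t → t ≤ 1# →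
               ((1# - t) ⊛ x ⊕ t ⊛ y) ∈ A

    IsDistance : Subset n → Subset n → Carrier → Set
    IsDistance A B = IsInfimum (λ d → ∃₂ λ x y → x ∈ A × y ∈ B × d ≈ ‖ x ⊖ y ‖)

    Hyperplane : ℝ^ n → Carrier → Subset n
    Hyperplane u c x = ⟨ u , x ⟩ ≈ c

  -- Two parallel hyperplanes have a common normal, which need not be a unit
  -- vector here.  The bounding hyperplanes may coincide, as they must for a
  -- supporting pair realising the width of a set contained in a hyperplane.
  record Plank (n : ℕ) : Set where
    field
      normal      : ℝ^ n
      normal≉0    : normal ∉ IsZero
      lower upper : Carrier
      lower≤upper : lower ≤ upper

    lowerHyperplane upperHyperplane region : Subset n
    lowerHyperplane = Hyperplane normal lower
    upperHyperplane  = Hyperplane normal upper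
    region x = lower ≤ ⟨ normal , x ⟩ × ⟨ normal , x ⟩ ≤ upper

    IsPlankWidth : Carrier → Set
    IsPlankWidth = IsDistance lowerHyperplane upperHyperplane

  open Plank

  module _ {n : ℕ} where

    BoundariesMeet : Subset n → Plank n → Set
    BoundariesMeet M P = lowerHyperplane P ≬ M × upperHyperplane P ≬ M

    -- M lies between the two hyperplanes and touches both, so that both are
    -- supporting hyperplanes of M.
    Supporting : Subset n → Plank n → Set
    Supporting M P = BoundariesMeet M P × M ⊆ region P

    IsWidth : Subset n → Carrier → Set
    IsWidth M = IsMinimum (λ d → ∃ λ P → Supporting M P × IsPlankWidth P d)

    Admissible : ∀ {k} → Subset n → Vector (ℝ^ n) k → Plank n → Set
    Admissible M x P = BoundariesMeet M P × (∀ i → x i ∉ Interior (region P))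

    AdmissibleWidth : ∀ {k} → Subset n → Vector (ℝ^ n) k → Pred Carrier 0ℓ
    AdmissibleWidth M x h = ∃ λ P → Admissible M x P × IsPlankWidth P h

{-# OPTIONS --safe #-}
module Submission where

-- Choose u ≠ 0 for which ⟨ u , _ ⟩ takes one value on the first n points (or on
-- all of them, if k < n).  By compactness ⟨ u , _ ⟩ attains its extrema a ≤ b on
-- M, and the hyperplanes ⟨ u , _ ⟩ = a, b support M, so w ≤ (b − a) / ‖ u ‖.  The
-- values at the given points cut [a , b] into at most 2 + (k ∸ n) gaps, each of
-- which is an admissible plank; their widths add up to (b − a) / ‖ u ‖, hence one
-- of them is at least w / (2 + (k ∸ n)).

open import Defs
open import Algebra.Bundles using (CommutativeRing; RawRing)
open import Algebra.Solver.Ring.AlmostCommutativeRing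
  using (fromCommutativeRing; _-Raw-AlmostCommutative⟶_)
open import Axiom.ExcludedMiddle using (ExcludedMiddle)
open import Data.Fin.Base as Fin using (Fin)
open import Data.List.Base as List using (List; []; _∷_; _++_; length)
open import Data.List.Membership.Propositional using (find)
open import Data.List.Membership.Propositional.Properties using (∈-∃++)
open import Data.List.Properties
  using (length-drop; length-map; length-tabulate; length-take; take++drop≡id)
open import Data.List.Relation.Binary.Permutation.Propositional
  using (↭-reflexive; ↭-sym; ↭-trans)
open import Data.List.Relation.Binary.Permutation.Propositional.Properties
  using (All-resp-↭; shift; ↭-length)
open import Data.List.Relation.Unary.All as All using (All; []; _∷_)
open import Data.List.Relation.Unary.All.Properties as All
  using (¬All⇒Any¬; drop⁺; map⁻; tabulate⁺; tabulate⁻; take⁺)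
open import Data.List.Relation.Unary.Any as Any using (Any; here; there)
open import Data.Maybe.Base using (Maybe; map)
open import Data.Nat.Base as ℕ using (ℕ; zero; suc)
open import Data.Product.Base using (∃; ∃₂; _×_; _,_; proj₁; proj₂)
open import Data.Sum.Base as Sum using (_⊎_; inj₁; inj₂)
open import Data.Vec.Functional as Vector using (Vector; tail)
open import Function.Base using (_∘_)
open import Level using (0ℓ)
open import Relation.Binary.Bundles using (TotalOrder)
open import Relation.Binary.PropositionalEquality.Core as ≡ using (_≡_)
open import Relation.Nullary.Decidable using (yes; no; dec⇒maybe)
open import Relation.Nullary.Negation using (¬_; contradiction)
open import Relation.Unary using (Pred; _∈_; _∉_; _≬_; Satisfiable)

import Algebra.Properties.AbelianGroup as AbelianGroupProperties
import Algebra.Properties.CommutativeSemigroup as CommutativeSemigroupProperties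
import Algebra.Properties.Monoid.Mult.TCOptimised as MultTCOptimised
import Algebra.Properties.Ring as RingProperties
import Algebra.Properties.Semiring.Mult as Mult
import Algebra.Solver.Ring as RingSolver
import Data.List.Extrema as Extrema
import Data.List.Relation.Unary.Any.Properties as Any
import Data.Nat.Properties as ℕ
import Relation.Binary.Construct.NonStrictToStrict as NonStrictToStrict
import Relation.Binary.Reasoning.Setoid as SetoidReasoning

-- The library's ring solver cannot cancel unless coefficient equality is
-- decidable by computation, so integers, encoded as reduced formal
-- differences of naturals, serve as coefficients.
module DifferenceSolver (R : CommutativeRing 0ℓ 0ℓ) where

  open CommutativeRing R
  open Mult semiring using (×-homo-+; ×1-homo-*) renaming (_×_ to _·_)
  open MultTCOptimised +-monoid using (×ᵤ≈×) renaming (_×_ to _·′_)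
  open RingProperties ring
    using (x[y-z]≈xy-xz; [y-z]x≈yx-zx; -0#≈0#)
  open AbelianGroupProperties +-abelianGroup using (⁻¹-∙-comm; ⁻¹-anti-homo-//)
  open CommutativeSemigroupProperties +-commutativeSemigroup using (interchange)
  open SetoidReasoning setoid

  private
    -+-interchange : ∀ x y z w → (x + z) - (y + w) ≈ (x - y) + (z - w)
    -+-interchange x y z w = begin
      (x + z) - (y + w)       ≈⟨ +-congˡ (⁻¹-∙-comm y w) ⟨
      (x + z) + (- y + - w)   ≈⟨ interchange x z (- y) (- w) ⟩
      (x - y) + (z - w)       ∎

    reduce : ℕ × ℕ → ℕ × ℕ
    reduce (a , b) = a ℕ.∸ b , b ℕ.∸ a

    Differences : RawRing 0ℓ 0ℓ
    Differences = record
      { Carrier = ℕ × ℕ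
      ; _≈_     = _≡_
      ; _+_     = λ (a , b) (c , d) → reduce (a ℕ.+ c , b ℕ.+ d)
      ; _*_     = λ (a , b) (c , d) →
                    reduce (a ℕ.* c ℕ.+ b ℕ.* d , a ℕ.* d ℕ.+ b ℕ.* c)
      ; -_      = λ (a , b) → b , a
      ; 0#      = 0 , 0
      ; 1#      = 1 , 0
      }

    difference value : ℕ × ℕ → Carrier
    difference (a , b) = a · 1# - b · 1#
    -- Constants must evaluate to 0# and 1# definitionally.
    value (a , 0)     = a ·′ 1#
    value (a , suc b) = difference (a , suc b)

    value≈difference : ∀ p → value p ≈ difference p
    value≈difference (a , 0) = begin
      a ·′ 1#        ≈⟨ ×ᵤ≈× a 1# ⟨
      a · 1#         ≈⟨ +-identityʳ (a · 1#) ⟨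
      a · 1# + 0#    ≈⟨ +-congˡ -0#≈0# ⟨
      a · 1# - 0#    ∎
    value≈difference (a , suc b) = refl

    -- Pairs stand for elements of the Grothendieck group of the naturals, where equality is
    -- equality of cross sums; `_coeff≟_` performs this test.
    difference-cong : ∀ a b c d → a ℕ.+ d ≡ c ℕ.+ b →
      difference (a , b) ≈ difference (c , d)
    difference-cong a b c d eq = begin
      A - B             ≈⟨ cancel A B D ⟨
      (A + D) - (B + D) ≈⟨ +-congʳ A+D≈C+B ⟩
      (C + B) - (B + D) ≈⟨ +-congˡ (-‿cong (+-comm B D)) ⟩
      (C + B) - (D + B) ≈⟨ cancel C D B ⟩
      C - D             ∎
      where
      A = a · 1#
      B = b · 1#
      C = c · 1#
      D = d · 1#
      A+D≈C+B : A + D ≈ C + B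
      A+D≈C+B = trans (sym (×-homo-+ 1# a d))
        (trans (reflexive (≡.cong (_· 1#) eq)) (×-homo-+ 1# c b))
      cancel : ∀ x y z → (x + z) - (y + z) ≈ x - y
      cancel x y z = begin
        (x + z) - (y + z) ≈⟨ -+-interchange x y z z ⟩
        (x - y) + (z - z) ≈⟨ +-congˡ (-‿inverseʳ z) ⟩
        (x - y) + 0#      ≈⟨ +-identityʳ (x - y) ⟩
        x - y             ∎

    value-reduce : ∀ a b → value (reduce (a , b)) ≈ difference (a , b)
    value-reduce a b = trans (value≈difference (reduce (a , b)))
      (difference-cong (a ℕ.∸ b) (b ℕ.∸ a) a b (∸+≡+∸ a b))
      where
      -- Both sides are the maximum of `a` and `b`.
      ∸+≡+∸ : ∀ a b → a ℕ.∸ b ℕ.+ b ≡ a ℕ.+ (b ℕ.∸ a)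
      ∸+≡+∸ zero    zero    = ≡.refl
      ∸+≡+∸ zero    (suc b) = ≡.refl
      ∸+≡+∸ (suc a) zero    = ≡.refl
      ∸+≡+∸ (suc a) (suc b) =
        ≡.trans (ℕ.+-suc (a ℕ.∸ b) b) (≡.cong suc (∸+≡+∸ a b))

    +·* : ∀ a b c d → (a ℕ.* b ℕ.+ c ℕ.* d) · 1# ≈
          (a · 1#) * (b · 1#) + (c · 1#) * (d · 1#)
    +·* a b c d = trans (×-homo-+ 1# (a ℕ.* b) (c ℕ.* d))
      (+-cong (×1-homo-* a b) (×1-homo-* c d))

    -*- : ∀ x y z w → (x * z + y * w) - (x * w + y * z) ≈ (x - y) * (z - w)
    -*- x y z w = begin
      (x * z + y * w) - (x * w + y * z)   ≈⟨ -+-interchange (x * z) (x * w) (y * w) (y * z) ⟩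
      (x * z - x * w) + (y * w - y * z)   ≈⟨ +-congˡ (⁻¹-anti-homo-// (y * z) (y * w)) ⟨
      (x * z - x * w) - (y * z - y * w)   ≈⟨ +-cong (x[y-z]≈xy-xz x z w) (-‿cong (x[y-z]≈xy-xz y z w)) ⟨
      x * (z - w) - y * (z - w)           ≈⟨ [y-z]x≈yx-zx (z - w) x y ⟨
      (x - y) * (z - w)                   ∎

    homomorphism : Differences -Raw-AlmostCommutative⟶ fromCommutativeRing R
    homomorphism = record
      { ⟦_⟧    = value
      ; +-homo = λ p@(a , b) q@(c , d) → trans (value-reduce (a ℕ.+ c) (b ℕ.+ d)) (trans
          (+-cong (×-homo-+ 1# a c) (-‿cong (×-homo-+ 1# b d))) (trans
          (-+-interchange (a · 1#) (b · 1#) (c · 1#) (d · 1#))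
          (sym (+-cong (value≈difference p) (value≈difference q)))))
      ; *-homo = λ p@(a , b) q@(c , d) → trans
          (value-reduce (a ℕ.* c ℕ.+ b ℕ.* d) (a ℕ.* d ℕ.+ b ℕ.* c)) (trans
          (+-cong (+·* a c b d) (-‿cong (+·* a d b c))) (trans
          (-*- (a · 1#) (b · 1#) (c · 1#) (d · 1#))
          (sym (*-cong (value≈difference p) (value≈difference q)))))
      ; -‿homo = λ p@(a , b) → trans (value≈difference (b , a)) (trans
          (sym (⁻¹-anti-homo-// (a · 1#) (b · 1#)))
          (sym (-‿cong (value≈difference p))))
      ; 0-homo = refl
      ; 1-homo = refl
      }

    _coeff≟_ : ∀ p q → Maybe (value p ≈ value q)
    p@(a , b) coeff≟ q@(c , d) = map
      (λ eq → trans (value≈difference p)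
        (trans (difference-cong a b c d eq) (sym (value≈difference q))))
      (dec⇒maybe (a ℕ.+ d ℕ.≟ c ℕ.+ b))

  open RingSolver Differences (fromCommutativeRing R) homomorphism _coeff≟_ public
    using (solve; con; _:+_; _:*_; _:-_; :-_; _:=_; Polynomial)

  :0 :1 : ∀ {n} → Polynomial n
  :0 = con (0 , 0)
  :1 = con (1 , 0)

-- Ordered field arithmetic

module OrderedField (em : ExcludedMiddle 0ℓ) (ℝ : CompleteOrderedField) where

  open CompleteOrderedField ℝ
  open FieldProperties ℝ
  open DifferenceSolver commutativeRing
  open NonStrictToStrict _≈_ _≤_ using (<⇒≱; ≰⇒>)

  totalOrder : TotalOrder 0ℓ 0ℓ 0ℓ
  totalOrder = record { isTotalOrder = isTotalOrder }

  <⇒≰ : ∀ {x y} → x < y → ¬ (y ≤ x)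
  <⇒≰ = <⇒≱ antisym

  ≰⇒< : ∀ {x y} → ¬ (x ≤ y) → y < x
  ≰⇒< = ≰⇒> sym ≤-reflexive total

  ≤-respˡ : ∀ {x y z} → x ≈ y → x ≤ z → y ≤ z
  ≤-respˡ x≈y = ≤-trans (≤-reflexive (sym x≈y))

  ≤-respʳ : ∀ {x y z} → x ≈ y → z ≤ x → z ≤ y
  ≤-respʳ x≈y z≤x = ≤-trans z≤x (≤-reflexive x≈y)

  -- Reduces an inequality to a certificate: an expression `e` that is visibly nonnegative, and an
  -- identity for the ring solver.
  ≤-by : ∀ {x y e} → 0# ≤ e → e ≈ y - x → x ≤ y
  ≤-by 0≤e e≈y-x = 0≤y-x⇒x≤y (≤-respʳ e≈y-x 0≤e)

  -- An equation that follows from a ≈ b, with cofactor k.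
  ≈-by : ∀ {x y a b} k → a ≈ b → x ≈ y + (a - b) * k → x ≈ y
  ≈-by {x} {y} {a} {b} k a≈b eq = trans eq (begin
    y + (a - b) * k ≈⟨ +-congˡ (*-congʳ (+-congʳ a≈b)) ⟩
    y + (b - b) * k ≈⟨ solve 3 (λ y b k → y :+ (b :- b) :* k := y) refl y b k ⟩
    y               ∎)
    where open SetoidReasoning setoid

  +-nonneg : ∀ {x y} → 0# ≤ x → 0# ≤ y → 0# ≤ x + y
  +-nonneg 0≤x 0≤y = ≤-respˡ (+-identityˡ 0#) (+-mono-≤ 0≤x 0≤y)

  *-monoʳ-≤ : ∀ {x y z} → 0# ≤ z → x ≤ y → x * z ≤ y * z
  *-monoʳ-≤ {x} {y} {z} 0≤z x≤y = ≤-by (*-nonneg (x≤y⇒0≤y-x x≤y) 0≤z)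
    (solve 3 (λ x y z → (y :- x) :* z := y :* z :- x :* z) refl x y z)

  inverse : ∀ {x} → ¬ (x ≈ 0#) → ∃ λ y → y * x ≈ 1#
  inverse x≉0 = let y , yx≈1 , _ = invertible x≉0 in y , yx≈1

  -- `y` equals `y * y * x`, a square times a nonnegative number.
  inverse-nonneg : ∀ {x y} → 0# ≤ x → y * x ≈ 1# → 0# ≤ y
  inverse-nonneg {x} {y} 0≤x yx≈1 = ≤-respʳ
    (≈-by y yx≈1 (solve 2 (λ x y → y :* y :* x := y :+ (y :* x :- :1) :* y) refl x y))
    (*-nonneg (0≤x*x y) 0≤x)

  *-cancelˡ-0 : ∀ {x y} → ¬ (x ≈ 0#) → x * y ≈ 0# → y ≈ 0#
  *-cancelˡ-0 {x} {y} x≉0 xy≈0 = let x⁻¹ , x⁻¹x≈1 = inverse x≉0 in begin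
    y               ≈⟨ *-identityˡ y ⟨
    1# * y          ≈⟨ *-congʳ x⁻¹x≈1 ⟨
    x⁻¹ * x * y     ≈⟨ *-assoc x⁻¹ x y ⟩
    x⁻¹ * (x * y)   ≈⟨ *-congˡ xy≈0 ⟩
    x⁻¹ * 0#        ≈⟨ zeroʳ x⁻¹ ⟩
    0#              ∎
    where open SetoidReasoning setoid

  x*x≈0⇒x≈0 : ∀ {x} → x * x ≈ 0# → x ≈ 0#
  x*x≈0⇒x≈0 {x} xx≈0 with em {P = x ≈ 0#}
  ... | yes x≈0 = x≈0
  ... | no  x≉0 = *-cancelˡ-0 x≉0 xx≈0

  *-pos : ∀ {x y} → 0# < x → 0# < y → 0# < x * y
  *-pos (0≤x , 0≉x) (0≤y , 0≉y) = *-nonneg 0≤x 0≤y ,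
    λ 0≈xy → 0≉y (sym (*-cancelˡ-0 (λ x≈0 → 0≉x (sym x≈0)) (sym 0≈xy)))

  inverse-pos : ∀ {x y} → 0# < x → y * x ≈ 1# → 0# < y
  inverse-pos {x} {y} (0≤x , _) yx≈1 = inverse-nonneg 0≤x yx≈1 ,
    λ 0≈y → 0≉1 (trans (sym (zeroˡ x)) (trans (*-congʳ 0≈y) yx≈1))

  1+nonneg-pos : ∀ {x} → 0# ≤ x → 0# < 1# + x
  1+nonneg-pos {x} 0≤x = +-nonneg 0≤1 0≤x , λ 0≈1+x → 0≉1 (antisym 0≤1
    (≤-by 0≤x (≈-by 1# (sym 0≈1+x)
      (solve 1 (λ x → x := (:0 :- :1) :+ ((:1 :+ x) :- :0) :* :1) refl x))))

  /-≤ : ∀ {w H} n → w ≤ (suc n ·ℕ 1#) * H → w / suc n ≤ H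
  /-≤ {w} {H} n w≤NH =
    let i , iN≈1 , _ = invertible (1+n·1≉0 n)
    in ≤-respʳ
         (≈-by H iN≈1 (solve 3 (λ N H i → N :* H :* i := H :+ (i :* N :- :1) :* H)
           refl (suc n ·ℕ 1#) H i))
         (*-monoʳ-≤ (inverse-nonneg (0≤n·1 (suc n)) iN≈1) w≤NH)

-- Inner products and norms

module EuclideanSpace (em : ExcludedMiddle 0ℓ) (ℝ : CompleteOrderedField) where

  open CompleteOrderedField ℝ
  open FieldProperties ℝ
  open Geometry ℝ
  open DifferenceSolver commutativeRing
  open OrderedField em ℝ
  open SetoidReasoning setoid

  dot-comm : ∀ {n} (x y : ℝ^ n) → ⟨ x , y ⟩ ≈ ⟨ y , x ⟩
  dot-comm {zero}  x y = refl
  dot-comm {suc n} x y =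
    +-cong (*-comm (x Fin.zero) (y Fin.zero)) (dot-comm (x ∘ Fin.suc) (y ∘ Fin.suc))

  -- Vectors are functions compared coordinatewise; taking the combination as a pointwise equation
  -- admits any `z` with the right coordinates, without extensionality.
  dot-linearʳ : ∀ {n} (v x y : ℝ^ n) {z} s t → (∀ i → z i ≈ s * x i + t * y i) →
                ⟨ v , z ⟩ ≈ s * ⟨ v , x ⟩ + t * ⟨ v , y ⟩
  dot-linearʳ {zero}  v x y s t z≈ =
    solve 2 (λ s t → :0 := s :* :0 :+ t :* :0) refl s t
  dot-linearʳ {suc n} v x y s t z≈ = trans
    (+-cong (*-congˡ (z≈ Fin.zero))
      (dot-linearʳ (v ∘ Fin.suc) (x ∘ Fin.suc) (y ∘ Fin.suc) s t (z≈ ∘ Fin.suc)))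
    (solve 7 (λ v x y s t p q →
        v :* (s :* x :+ t :* y) :+ (s :* p :+ t :* q)
          := s :* (v :* x :+ p) :+ t :* (v :* y :+ q))
      refl (v Fin.zero) (x Fin.zero) (y Fin.zero) s t
      ⟨ v ∘ Fin.suc , x ∘ Fin.suc ⟩ ⟨ v ∘ Fin.suc , y ∘ Fin.suc ⟩)

  dot-⊖ : ∀ {n} (v x y : ℝ^ n) → ⟨ v , x ⊖ y ⟩ ≈ ⟨ v , x ⟩ - ⟨ v , y ⟩
  dot-⊖ v x y = trans
    (dot-linearʳ v x y 1# (- 1#)
      (λ i → solve 2 (λ x y → x :- y := :1 :* x :+ (:- :1) :* y) refl (x i) (y i)))
    (solve 2 (λ x y → :1 :* x :+ (:- :1) :* y := x :- y) refl ⟨ v , x ⟩ ⟨ v , y ⟩)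

  dot-scaleʳ : ∀ {n} (v x : ℝ^ n) {z} t → (∀ i → z i ≈ t * x i) → ⟨ v , z ⟩ ≈ t * ⟨ v , x ⟩
  dot-scaleʳ v x t z≈ = trans
    (dot-linearʳ v x x t 0# (λ i → trans (z≈ i) (expand (x i))))
    (sym (expand ⟨ v , x ⟩))
    where
    expand : ∀ a → t * a ≈ t * a + 0# * a
    expand = solve 2 (λ t a → t :* a := t :* a :+ :0 :* a) refl t

  dot-scale² : ∀ {n} (x : ℝ^ n) {z} t → (∀ i → z i ≈ t * x i) →
               ⟨ z , z ⟩ ≈ t * t * ⟨ x , x ⟩
  dot-scale² x {z} t z≈ = begin
    ⟨ z , z ⟩           ≈⟨ dot-scaleʳ z x t z≈ ⟩
    t * ⟨ z , x ⟩       ≈⟨ *-congˡ (dot-comm z x) ⟩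
    t * ⟨ x , z ⟩       ≈⟨ *-congˡ (dot-scaleʳ x x t z≈) ⟩
    t * (t * ⟨ x , x ⟩) ≈⟨ *-assoc t t ⟨ x , x ⟩ ⟨
    t * t * ⟨ x , x ⟩   ∎

  -- The nonnegativity of the left side is the source of the two estimates of Cauchy-Schwarz type,
  -- `norm-projection-≤` and `dot-continuous`.
  dot-residual² : ∀ {n} (z u : ℝ^ n) t → ⟨ z ⊖ t ⊛ u , z ⊖ t ⊛ u ⟩ ≈
                  ⟨ z , z ⟩ - (1# + 1#) * t * ⟨ u , z ⟩ + t * t * ⟨ u , u ⟩
  dot-residual² z u t = begin
    ⟨ r , r ⟩                     ≈⟨ right r ⟩
    ⟨ r , z ⟩ - t * ⟨ r , u ⟩     ≈⟨ +-cong (left z) (-‿cong (*-congˡ (left u))) ⟩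
    (zz - t * ⟨ z , u ⟩) - t * (uz - t * uu)
      ≈⟨ +-congʳ (+-congˡ (-‿cong (*-congˡ (dot-comm z u)))) ⟩
    (zz - t * uz) - t * (uz - t * uu)
      ≈⟨ solve 4 (λ zz uz uu t → (zz :- t :* uz) :- t :* (uz :- t :* uu)
           := zz :- (:1 :+ :1) :* t :* uz :+ t :* t :* uu) refl zz uz uu t ⟩
    zz - (1# + 1#) * t * uz + t * t * uu ∎
    where
    r = z ⊖ t ⊛ u
    zz = ⟨ z , z ⟩
    uz = ⟨ u , z ⟩
    uu = ⟨ u , u ⟩
    right : ∀ v → ⟨ v , r ⟩ ≈ ⟨ v , z ⟩ - t * ⟨ v , u ⟩
    right v = trans (dot-⊖ v z (t ⊛ u)) (+-congˡ (-‿cong (dot-scaleʳ v u t (λ _ → refl))))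
    left : ∀ v → ⟨ r , v ⟩ ≈ ⟨ v , z ⟩ - t * ⟨ v , u ⟩
    left v = trans (dot-comm r v) (right v)

  dot-definite : ∀ {n} (x : ℝ^ n) → ⟨ x , x ⟩ ≈ 0# → x ∈ IsZero
  dot-definite {suc n} x xx≈0 = λ where
      Fin.zero    → x*x≈0⇒x≈0 (squeeze (0≤x*x x₀) (0≤⟨x,x⟩ x′) xx≈0)
      (Fin.suc i) → dot-definite x′
        (squeeze (0≤⟨x,x⟩ x′) (0≤x*x x₀) (trans (+-comm ⟨ x′ , x′ ⟩ (x₀ * x₀)) xx≈0)) i
    where
    x₀ = x Fin.zero
    x′ = x ∘ Fin.suc
    squeeze : ∀ {a b} → 0# ≤ a → 0# ≤ b → a + b ≈ 0# → a ≈ 0#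
    squeeze {a} {b} 0≤a 0≤b a+b≈0 = antisym (≤-by 0≤b (≈-by 1# a+b≈0
      (solve 2 (λ a b → b := (:0 :- a) :+ ((a :+ b) :- :0) :* :1) refl a b))) 0≤a

  dot-pos : ∀ {n} {u : ℝ^ n} → u ∉ IsZero → 0# < ⟨ u , u ⟩
  dot-pos {u = u} u≉0 = 0≤⟨x,x⟩ u , λ 0≈uu → u≉0 (dot-definite u (sym 0≈uu))

  module _ {n} (x : ℝ^ n) where

    private
      ‖x‖-isSupremum : IsSupremum (λ t → t * t ≤ ⟨ x , x ⟩) ‖ x ‖
      ‖x‖-isSupremum = proj₂ (supremum _ _ _)

    ≤-norm : ∀ {t} → t * t ≤ ⟨ x , x ⟩ → t ≤ ‖ x ‖
    ≤-norm = proj₁ ‖x‖-isSupremum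

    norm-≤ : ∀ {b} → (∀ {t} → t * t ≤ ⟨ x , x ⟩ → t ≤ b) → ‖ x ‖ ≤ b
    norm-≤ = proj₂ ‖x‖-isSupremum

    norm-nonneg : 0# ≤ ‖ x ‖
    norm-nonneg = ≤-norm (≤-respˡ (sym (zeroˡ 0#)) (0≤⟨x,x⟩ x))

  norm-mono : ∀ {m n} (x : ℝ^ m) (y : ℝ^ n) → ⟨ x , x ⟩ ≤ ⟨ y , y ⟩ → ‖ x ‖ ≤ ‖ y ‖
  norm-mono x y xx≤yy = norm-≤ x (λ tt≤xx → ≤-norm y (≤-trans tt≤xx xx≤yy))

  -- For `t ≉ 0`, if `r` competes in the supremum `‖ z ‖` then `r * t⁻¹` competes in `‖ u ‖`; for
  -- `t ≈ 0` a competitor must vanish. Only the square of `t` enters the hypothesis, so `z` may also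
  -- be `(- t) ⊛ u`.
  norm-scale-≤ : ∀ {n} (u z : ℝ^ n) {t} → 0# ≤ t → ⟨ z , z ⟩ ≈ t * t * ⟨ u , u ⟩ →
                 ‖ z ‖ ≤ t * ‖ u ‖
  norm-scale-≤ u z {t} 0≤t zz≈ with em {P = t ≈ 0#}
  ... | yes t≈0 = norm-≤ z λ {r} rr≤zz → ≤-trans
        (≤-reflexive (x*x≈0⇒x≈0 (antisym (≤-respʳ zz≈0 rr≤zz) (0≤x*x r))))
        (*-nonneg 0≤t (norm-nonneg u))
    where
    zz≈0 : ⟨ z , z ⟩ ≈ 0#
    zz≈0 = trans zz≈ (≈-by (t * ⟨ u , u ⟩) t≈0
      (solve 2 (λ t uu → t :* t :* uu := :0 :+ (t :- :0) :* (t :* uu)) refl t ⟨ u , u ⟩))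
  ... | no t≉0 = norm-≤ z λ {r} rr≤zz →
        let t⁻¹ , t⁻¹t≈1 = inverse t≉0
            uu = ⟨ u , u ⟩
            0≤t⁻¹ = inverse-nonneg 0≤t t⁻¹t≈1
            r/t≤‖u‖ : r * t⁻¹ ≤ ‖ u ‖
            r/t≤‖u‖ = ≤-norm u (≤-respʳ
              (≈-by (uu * (t * t⁻¹ + 1#)) t⁻¹t≈1
                (solve 3 (λ t t⁻¹ uu → t :* t :* uu :* (t⁻¹ :* t⁻¹)
                    := uu :+ (t⁻¹ :* t :- :1) :* (uu :* (t :* t⁻¹ :+ :1)))
                  refl t t⁻¹ uu))
              (≤-respˡ (solve 2 (λ r t⁻¹ → r :* r :* (t⁻¹ :* t⁻¹) := r :* t⁻¹ :* (r :* t⁻¹))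
                  refl r t⁻¹)
                (*-monoʳ-≤ (*-nonneg 0≤t⁻¹ 0≤t⁻¹) (≤-respʳ zz≈ rr≤zz))))
        in ≤-respʳ (*-comm ‖ u ‖ t) (≤-respˡ
             (≈-by r t⁻¹t≈1 (solve 3 (λ r t t⁻¹ →
               r :* t⁻¹ :* t := r :+ (t⁻¹ :* t :- :1) :* r) refl r t t⁻¹))
             (*-monoʳ-≤ 0≤t r/t≤‖u‖))

  -- For `t ≉ 0` the vector `u` is `t⁻¹` times `t ⊛ u`, so `norm-scale-≤` applies in the opposite
  -- direction.
  norm-scale-≥ : ∀ {n} (u : ℝ^ n) {t} → 0# ≤ t → t * ‖ u ‖ ≤ ‖ t ⊛ u ‖
  norm-scale-≥ u {t} 0≤t with em {P = t ≈ 0#}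
  ... | yes t≈0 = ≤-respˡ (sym (trans (*-congʳ t≈0) (zeroˡ ‖ u ‖))) (norm-nonneg (t ⊛ u))
  ... | no t≉0 =
        let t⁻¹ , t⁻¹t≈1 = inverse t≉0
            uu = ⟨ u , u ⟩
            ‖u‖≤ : ‖ u ‖ ≤ t⁻¹ * ‖ t ⊛ u ‖
            ‖u‖≤ = norm-scale-≤ (t ⊛ u) u (inverse-nonneg 0≤t t⁻¹t≈1) (sym (trans
              (*-congˡ (dot-scale² u t (λ _ → refl)))
              (≈-by (uu * (t * t⁻¹ + 1#)) t⁻¹t≈1
                (solve 3 (λ t t⁻¹ uu → t⁻¹ :* t⁻¹ :* (t :* t :* uu)
                    := uu :+ (t⁻¹ :* t :- :1) :* (uu :* (t :* t⁻¹ :+ :1)))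
                  refl t t⁻¹ uu))))
        in ≤-respˡ (*-comm ‖ u ‖ t) (≤-respʳ
             (≈-by ‖ t ⊛ u ‖ t⁻¹t≈1 (solve 3 (λ r t t⁻¹ →
               t⁻¹ :* r :* t := r :+ (t⁻¹ :* t :- :1) :* r) refl ‖ t ⊛ u ‖ t t⁻¹))
             (*-monoʳ-≤ 0≤t ‖u‖≤))

  -- `⟨ z , z ⟩ - t * t * ⟨ u , u ⟩` is the squared length of `z ⊖ t ⊛ u` plus
  -- `2 t (⟨ u , z ⟩ - t * ⟨ u , u ⟩)`, and both terms are nonnegative.
  norm-projection-≤ : ∀ {n} (u z : ℝ^ n) {t} → 0# ≤ t → t * ⟨ u , u ⟩ ≤ ⟨ u , z ⟩ →
                      ‖ t ⊛ u ‖ ≤ ‖ z ‖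
  norm-projection-≤ u z {t} 0≤t tuu≤uz = norm-mono (t ⊛ u) z (≤-respˡ
    (sym (dot-scale² u t (λ _ → refl)))
    (≤-by (+-nonneg (0≤⟨x,x⟩ (z ⊖ t ⊛ u))
            (*-nonneg (+-nonneg 0≤t 0≤t) (x≤y⇒0≤y-x tuu≤uz)))
      (trans (+-congʳ (dot-residual² z u t))
        (solve 4 (λ zz uz uu t →
            (zz :- (:1 :+ :1) :* t :* uz :+ t :* t :* uu) :+ (t :+ t) :* (uz :- t :* uu)
              := zz :- t :* t :* uu)
          refl ⟨ z , z ⟩ ⟨ u , z ⟩ ⟨ u , u ⟩ t))))

  -- The radius is `t = η / (1 + ⟨ u , u ⟩)`, where the 1 keeps the denominator positive even if `u`
  -- is zero. Then `⟨ z , z ⟩ - t * t` splits into the squared length of `z ⊖ t ⊛ u`,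
  -- `2 t (⟨ u , z ⟩ - η)` and `t * η`.
  dot-continuous : ∀ {n} (u : ℝ^ n) {η} → 0# < η →
                   ∃ λ ε → 0# < ε × (∀ z → η ≤ ⟨ u , z ⟩ → ε ≤ ‖ z ‖)
  dot-continuous u {η} 0<η@(0≤η , _) =
    let uu = ⟨ u , u ⟩
        0<1+uu@(0≤1+uu , 0≉1+uu) = 1+nonneg-pos (0≤⟨x,x⟩ u)
        i , i[1+uu]≈1 = inverse (λ 1+uu≈0 → 0≉1+uu (sym 1+uu≈0))
        t = i * η
        0<t@(0≤t , _) = *-pos (inverse-pos 0<1+uu i[1+uu]≈1) 0<η
    in t , 0<t , λ z η≤uz → ≤-norm z
      (≤-by (+-nonneg (+-nonneg (0≤⟨x,x⟩ (z ⊖ t ⊛ u))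
              (*-nonneg (+-nonneg 0≤t 0≤t) (x≤y⇒0≤y-x η≤uz)))
              (*-nonneg 0≤t 0≤η))
        (trans (+-congʳ (+-congʳ (dot-residual² z u t)))
          (≈-by (t * η) i[1+uu]≈1
            (solve 5 (λ zz uz uu i η →
                (zz :- (:1 :+ :1) :* (i :* η) :* uz :+ (i :* η) :* (i :* η) :* uu)
                  :+ (i :* η :+ i :* η) :* (uz :- η) :+ (i :* η) :* η
                := (zz :- (i :* η) :* (i :* η)) :+ (i :* (:1 :+ uu) :- :1) :* ((i :* η) :* η))
              refl ⟨ z , z ⟩ ⟨ u , z ⟩ uu i η))))

  -- Halfspaces and extrema of linear functionals on compact sets

  halfspace-open : ∀ {n} (u : ℝ^ n) c → Open (λ x → ⟨ u , x ⟩ < c)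
  halfspace-open u c {x} ux<c@(ux≤c , ux≉c) =
    let ε , 0<ε , ε≤ = dot-continuous u {c - ⟨ u , x ⟩} (x≤y⇒0≤y-x ux≤c , λ 0≈c-ux →
          ux≉c (≈-by 1# 0≈c-ux
            (solve 2 (λ ux c → ux := c :+ (:0 :- (c :- ux)) :* :1) refl ⟨ u , x ⟩ c)))
    in ε , 0<ε , λ {y} ‖y-x‖<ε → ≰⇒< λ c≤uy → <⇒≰ ‖y-x‖<ε (ε≤ (y ⊖ x)
         (≤-respʳ (sym (dot-⊖ u y x)) (+-monoˡ-≤ (- ⟨ u , x ⟩) c≤uy)))

  module _ {n} {M : Subset n} (M-sat : Satisfiable M) (M-compact : Compact M) where

    -- Otherwise the halfspaces ⟨ u , _ ⟩ < ⟨ u , y ⟩ with y ∈ M cover M.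
    attains-maximum : ∀ u → ∃ λ a → a ∈ M × (∀ {y} → y ∈ M → ⟨ u , y ⟩ ≤ ⟨ u , a ⟩)
    attains-maximum u with em {P = ∃ λ a → a ∈ M × (∀ {y} → y ∈ M → ⟨ u , y ⟩ ≤ ⟨ u , a ⟩)}
    ... | yes attained = attained
    ... | no  unattained =
      let is , is-covers = M-compact (∃ (_∈ M)) (λ (y , _) x → ⟨ u , x ⟩ < ⟨ u , y ⟩)
            (λ (y , _) → halfspace-open u ⟨ u , y ⟩) covered
          -- A highest point among `M-sat` and the points indexing the subcover lies in none of the
          -- chosen halfspaces; the default `M-sat` makes it exist for an empty list too.
          a , a∈M = argmax height M-sat is
      in contradiction (is-covers a∈M) λ below →
           All.lookupWith (λ y≤a a<y → <⇒≰ a<y y≤a) (f[xs]≤f[argmax] M-sat is) below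
      where
      open Extrema totalOrder using (argmax; f[xs]≤f[argmax])
      height : ∃ (_∈ M) → Carrier
      height (y , _) = ⟨ u , y ⟩
      covered : ∀ {x} → x ∈ M → ∃ λ ((y , _) : ∃ (_∈ M)) → ⟨ u , x ⟩ < ⟨ u , y ⟩
      covered {x} x∈M with em {P = ∃ λ ((y , _) : ∃ (_∈ M)) → ⟨ u , x ⟩ < ⟨ u , y ⟩}
      ... | yes above = above
      ... | no ¬above = contradiction (x , x∈M , λ {y} y∈M → ≤-or-above y∈M) unattained
        where
        ≤-or-above : ∀ {y} → y ∈ M → ⟨ u , y ⟩ ≤ ⟨ u , x ⟩
        ≤-or-above {y} y∈M with em {P = ⟨ u , y ⟩ ≤ ⟨ u , x ⟩}
        ... | yes y≤x = y≤x
        ... | no  y≰x = contradiction ((y , y∈M) , ≰⇒< y≰x) ¬above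

    attains-minimum : ∀ u → ∃ λ a → a ∈ M × (∀ {y} → y ∈ M → ⟨ u , a ⟩ ≤ ⟨ u , y ⟩)
    attains-minimum u =
      let a , a∈M , ≤a = attains-maximum ((- 1#) ⊛ u)
      in a , a∈M , λ {y} y∈M → ≤-by (x≤y⇒0≤y-x (≤a y∈M)) (trans
           (+-cong (neg a) (-‿cong (neg y)))
           (solve 2 (λ a y → (:- :1) :* a :- (:- :1) :* y := y :- a) refl ⟨ u , a ⟩ ⟨ u , y ⟩))
      where
      neg : ∀ y → ⟨ (- 1#) ⊛ u , y ⟩ ≈ (- 1#) * ⟨ u , y ⟩
      neg y = trans (dot-comm ((- 1#) ⊛ u) y) (trans
        (dot-scaleʳ y u (- 1#) (λ _ → refl)) (*-congˡ (dot-comm y u)))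

  zero-vector : ∀ {n} → ℝ^ n
  zero-vector _ = 0#

  dot-zeroˡ : ∀ {n} (v : ℝ^ n) → ⟨ zero-vector , v ⟩ ≈ 0#
  dot-zeroˡ v = trans (dot-comm zero-vector v)
    (trans (dot-scaleʳ v zero-vector 0# (λ _ → sym (zeroˡ 0#))) (zeroˡ _))

  basis : ∀ {n} → Fin n → ℝ^ n
  basis Fin.zero    = 1# Vector.∷ zero-vector
  basis (Fin.suc i) = 0# Vector.∷ basis i

  dot-basis : ∀ {n} i (v : ℝ^ n) → ⟨ basis i , v ⟩ ≈ v i
  dot-basis Fin.zero    v = trans (+-cong (*-identityˡ (v Fin.zero)) (dot-zeroˡ (v ∘ Fin.suc)))
                              (+-identityʳ (v Fin.zero))
  dot-basis (Fin.suc i) v = trans (+-cong (zeroˡ (v Fin.zero)) (dot-basis i (v ∘ Fin.suc)))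
                              (+-identityˡ (v (Fin.suc i)))

  dot-mono : ∀ {n} (x d : ℝ^ n) → (∀ i → x i * x i ≤ d i * d i) → ⟨ x , x ⟩ ≤ ⟨ d , d ⟩
  dot-mono {zero}  x d xx≤dd = ≤-refl
  dot-mono {suc n} x d xx≤dd =
    +-mono-≤ (xx≤dd Fin.zero) (dot-mono (x ∘ Fin.suc) (d ∘ Fin.suc) (xx≤dd ∘ Fin.suc))

  -- The coordinatewise extrema enclose `M` in a box, and `D` is the length of its diagonal.
  compact-diameter : ∀ {n} {M : Subset n} → Satisfiable M → Compact M →
                     ∃ λ D → ∀ {x y} → x ∈ M → y ∈ M → ‖ x ⊖ y ‖ ≤ D
  compact-diameter {n} {M} M-sat M-compact = ‖ extent ‖ , λ {x} {y} x∈M y∈M →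
      norm-mono (x ⊖ y) extent (dot-mono (x ⊖ y) extent λ i →
        -- With `d` the extent and `e = x i - y i`, the difference `d * d - e * e` is
        -- `(d - e) * (d + e)`; the two factors are nonnegative by the bounds for `x , y` and for
        -- `y , x`.
        ≤-by (*-nonneg (x≤y⇒0≤y-x (coordinate-bound i x∈M y∈M))
                       (x≤y⇒0≤y-x (coordinate-bound i y∈M x∈M)))
          (solve 3 (λ x y d → (d :- (x :- y)) :* (d :- (y :- x))
              := d :* d :- (x :- y) :* (x :- y)) refl (x i) (y i) (extent i)))
    where
    top bottom extent : ℝ^ n
    top i    = ⟨ basis i , proj₁ (attains-maximum M-sat M-compact (basis i)) ⟩
    bottom i = ⟨ basis i , proj₁ (attains-minimum M-sat M-compact (basis i)) ⟩
    extent i = top i - bottom i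
    coordinate-bound : ∀ i {x y} → x ∈ M → y ∈ M → x i - y i ≤ extent i
    coordinate-bound i {x} {y} x∈M y∈M =
      let _ , _ , ≤top    = attains-maximum M-sat M-compact (basis i)
          _ , _ , bottom≤ = attains-minimum M-sat M-compact (basis i)
      in ≤-by (+-nonneg (x≤y⇒0≤y-x (≤-respˡ (dot-basis i x) (≤top x∈M)))
                        (x≤y⇒0≤y-x (≤-respʳ (dot-basis i y) (bottom≤ y∈M))))
           (solve 4 (λ x y t b → (t :- x) :+ (y :- b) := (t :- b) :- (x :- y)) refl
             (x i) (y i) (top i) (bottom i))

  -- Normal vectors by elimination

  Normal : ∀ {n} → List (ℝ^ n) → Set
  Normal as = ∃ λ u → u ∉ IsZero × All (λ a → ⟨ u , a ⟩ ≈ 0#) as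

  -- Gaussian elimination: a pivot vector with nonzero first coordinate clears
  -- the first coordinates of the other vectors.
  mutual
    normal-vector : ∀ n (as : List (ℝ^ (suc n))) → length as ℕ.≤ n → Normal as
    normal-vector n as ∣as∣≤n with All.all? (λ a → em {P = a Fin.zero ≈ 0#}) as
    ... | yes heads≈0 = basis Fin.zero , (λ e≈0 → 0≉1 (sym (e≈0 Fin.zero))) ,
          All.map (λ {a} a₀≈0 → trans (dot-basis Fin.zero a) a₀≈0) heads≈0
    ... | no ¬heads≈0 =
          let a , a∈as , a₀≉0  = find (¬All⇒Any¬ (λ a → em) as ¬heads≈0)
              bs , cs , as≡    = ∈-∃++ a∈as
              as↭              = ↭-trans (↭-reflexive as≡) (shift a bs cs)
              u , u≉0 , u⊥a∷ds = eliminate n a (bs ++ cs) a₀≉0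
                                   (≡.subst (ℕ._≤ n) (↭-length as↭) ∣as∣≤n)
          in u , u≉0 , All-resp-↭ (↭-sym as↭) u⊥a∷ds

    eliminate : ∀ n (a : ℝ^ (suc n)) ds → ¬ (a Fin.zero ≈ 0#) →
                suc (length ds) ℕ.≤ n → Normal (a ∷ ds)
    eliminate (suc n) a ds a₀≉0 (ℕ.s≤s ∣ds∣≤n) =
      let v , v≉0 , v⊥ = normal-vector n (List.map reduce ds)
            (≡.subst (ℕ._≤ n) (≡.sym (length-map reduce ds)) ∣ds∣≤n)
          va = ⟨ v , tail a ⟩
          -- Chosen so that the new vector is orthogonal to the pivot `a`; its product with each `d`
          -- then equals that of `v` with the reduced `d`.
          u₀ = - (a₀⁻¹ * va)
      in u₀ Vector.∷ v , (λ u≈0 → v≉0 (u≈0 ∘ Fin.suc)) ,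
         ≈-by (- va) a₀⁻¹a₀≈1
           (solve 3 (λ a₀ a₀⁻¹ va → :- (a₀⁻¹ :* va) :* a₀ :+ va
               := :0 :+ (a₀⁻¹ :* a₀ :- :1) :* (:- va)) refl a₀ a₀⁻¹ va)
         ∷ All.map (λ {d} v⊥d → trans
             (solve 4 (λ a₀⁻¹ va d₀ vd → :- (a₀⁻¹ :* va) :* d₀ :+ vd
                 := :1 :* vd :+ :- (d₀ :* a₀⁻¹) :* va)
               refl a₀⁻¹ va (d Fin.zero) ⟨ v , tail d ⟩)
             (trans (sym (dot-linearʳ v (tail d) (tail a) 1# (- (d Fin.zero * a₀⁻¹))
               (λ _ → refl))) v⊥d))
           (map⁻ v⊥)
      where
      a₀ = a Fin.zero
      a₀⁻¹ = proj₁ (inverse a₀≉0)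
      a₀⁻¹a₀≈1 = proj₂ (inverse a₀≉0)
      reduce : ℝ^ (suc (suc n)) → ℝ^ (suc n)
      -- The factor `1#` matches the shape in `dot-linearʳ`, whose pointwise hypothesis then holds
      -- by `refl`.
      reduce d i = 1# * tail d i + - (d Fin.zero * a₀⁻¹) * tail a i

-- Strips: width and interior

module Strip (em : ExcludedMiddle 0ℓ) (ℝ : CompleteOrderedField)
  {n} {u : Geometry.ℝ^ ℝ n} (u≉0 : u ∉ Geometry.IsZero ℝ) where

  open CompleteOrderedField ℝ
  open FieldProperties ℝ
  open Geometry ℝ
  open DifferenceSolver commutativeRing
  open OrderedField em ℝ
  open EuclideanSpace em ℝ

  strip : ∀ {l m} → l ≤ m → Plank n
  strip l≤m = record { normal = u ; normal≉0 = u≉0 ; lower≤upper = l≤m }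

  private
    uu = ⟨ u , u ⟩

    uu-inverse : ∃ λ i → i * uu ≈ 1#
    uu-inverse = inverse (λ uu≈0 → proj₂ (dot-pos u≉0) (sym uu≈0))

    i = proj₁ uu-inverse
    i*uu≈1 = proj₂ uu-inverse

    0≤i : 0# ≤ i
    0≤i = inverse-nonneg (0≤⟨x,x⟩ u) i*uu≈1

  -- 1 / ‖ u ‖
  scale : Carrier
  scale = i * ‖ u ‖

  -- With `t = (m - l) / ⟨ u , u ⟩`, the difference of points on the two hyperplanes has inner
  -- product `t * ⟨ u , u ⟩` with `u`, up to sign, hence length at least `t * ‖ u ‖`. The feet of
  -- the perpendiculars from the origin attain this length.
  strip-width : ∀ {l m} (l≤m : l ≤ m) → Plank.IsPlankWidth (strip l≤m) ((m - l) * scale)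
  strip-width {l} {m} l≤m = lower-bound , greatest
    where
    t = (m - l) * i
    0≤t = *-nonneg (x≤y⇒0≤y-x l≤m) 0≤i
    t*‖u‖≈ : t * ‖ u ‖ ≈ (m - l) * scale
    t*‖u‖≈ = *-assoc (m - l) i ‖ u ‖

    lower-bound : ∀ {d} → (∃₂ λ x y → ⟨ u , x ⟩ ≈ l × ⟨ u , y ⟩ ≈ m × d ≈ ‖ x ⊖ y ‖) →
                  (m - l) * scale ≤ d
    lower-bound (x , y , ux≈l , uy≈m , d≈) = ≤-respˡ t*‖u‖≈ (≤-respʳ (sym d≈)
      (≤-trans (norm-scale-≥ u 0≤t) (≤-trans
        (norm-projection-≤ u (y ⊖ x) 0≤t (≤-reflexive (trans
          (≈-by (m - l) i*uu≈1 (solve 4 (λ m l i uu → (m :- l) :* i :* uu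
            := (m :- l) :+ (i :* uu :- :1) :* (m :- l)) refl m l i uu))
          (sym (trans (dot-⊖ u y x) (+-cong uy≈m (-‿cong ux≈l)))))))
        (norm-mono (y ⊖ x) (x ⊖ y) (≤-reflexive (trans
          (dot-scale² (x ⊖ y) {y ⊖ x} (- 1#) (λ j →
            solve 2 (λ x y → y :- x := (:- :1) :* (x :- y)) refl (x j) (y j)))
          (solve 1 (λ q → (:- :1) :* (:- :1) :* q := q) refl ⟨ x ⊖ y , x ⊖ y ⟩)))))))

    foot : Carrier → ℝ^ n
    foot c = (c * i) ⊛ u

    u-foot : ∀ c → ⟨ u , foot c ⟩ ≈ c
    u-foot c = trans (dot-scaleʳ u u (c * i) (λ _ → refl))
      (≈-by c i*uu≈1
        (solve 3 (λ c i uu → c :* i :* uu := c :+ (i :* uu :- :1) :* c) refl c i uu))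

    greatest : ∀ {b} → (∀ {d} → (∃₂ λ x y → ⟨ u , x ⟩ ≈ l × ⟨ u , y ⟩ ≈ m × d ≈ ‖ x ⊖ y ‖) →
               b ≤ d) → b ≤ (m - l) * scale
    greatest b≤ = ≤-trans (b≤ (foot l , foot m , u-foot l , u-foot m , refl)) (≤-respʳ t*‖u‖≈
      (norm-scale-≤ u (foot l ⊖ foot m) 0≤t (trans
        (dot-scale² u {foot l ⊖ foot m} (- t) (λ j →
          solve 4 (λ l m i u → l :* i :* u :- m :* i :* u := (:- ((m :- l) :* i)) :* u)
            refl l m i (u j)))
        (solve 2 (λ t uu → (:- t) :* (:- t) :* uu := t :* t :* uu) refl t uu))))

  -- The points `x ± t u` with `t = ε / (1 + ‖ u ‖)` lie in the ball, as `ε - t * ‖ u ‖ ≈ t` is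
  -- positive, and hence in the strip. Their values lie on either side of `⟨ u , x ⟩`, at the
  -- positive distance `t * ⟨ u , u ⟩`.
  interior⇒strictly-between : ∀ {l m} (l≤m : l ≤ m) {x} →
    x ∈ Interior (Plank.region (strip l≤m)) → l < ⟨ u , x ⟩ × ⟨ u , x ⟩ < m
  interior⇒strictly-between {l} {m} l≤m {x} (ε , 0<ε@(0≤ε , _) , ball⊆) =
      ≰⇒< (λ ux≤l → <⇒≰ 0<t*uu (≤-by
        (+-nonneg (x≤y⇒0≤y-x (proj₁ (ball⊆ (near (- t) (λ uu →
            solve 2 (λ t uu → (:- t) :* (:- t) :* uu := t :* t :* uu) refl t uu)))))
          (x≤y⇒0≤y-x ux≤l))
        (trans (+-congʳ (+-congʳ (u-shift (- t))))
          (solve 4 (λ ux t uu l → ((ux :+ (:- t) :* uu) :- l) :+ (l :- ux) := :0 :- t :* uu)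
            refl ⟨ u , x ⟩ t uu l)))) ,
      ≰⇒< (λ m≤ux → <⇒≰ 0<t*uu (≤-by
        (+-nonneg (x≤y⇒0≤y-x (proj₂ (ball⊆ (near t (λ _ → refl))))) (x≤y⇒0≤y-x m≤ux))
        (trans (+-congʳ (+-congˡ (-‿cong (u-shift t))))
          (solve 4 (λ ux t uu m → (m :- (ux :+ t :* uu)) :+ (ux :- m) := :0 :- t :* uu)
            refl ⟨ u , x ⟩ t uu m))))
    where
    0<1+‖u‖ = 1+nonneg-pos (norm-nonneg u)
    j-inverse = inverse (λ eq → proj₂ 0<1+‖u‖ (sym eq))
    j = proj₁ j-inverse
    t = ε * j
    0<t : 0# < t
    0<t = *-pos 0<ε (inverse-pos 0<1+‖u‖ (proj₂ j-inverse))
    0<t*uu = *-pos 0<t (dot-pos u≉0)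

    ε-t*‖u‖≈t : ε - t * ‖ u ‖ ≈ t
    ε-t*‖u‖≈t = ≈-by (- ε) (proj₂ j-inverse)
      (solve 3 (λ ε j N → ε :- ε :* j :* N
        := ε :* j :+ (j :* (:1 :+ N) :- :1) :* (:- ε)) refl ε j ‖ u ‖)

    t*‖u‖<ε : t * ‖ u ‖ < ε
    t*‖u‖<ε = ≰⇒< λ ε≤ → <⇒≰ 0<t (≤-by (x≤y⇒0≤y-x ε≤)
      (≈-by (- 1#) ε-t*‖u‖≈t (solve 3 (λ ε p t →
        p :- ε := (:0 :- t) :+ ((ε :- p) :- t) :* (:- :1)) refl ε (t * ‖ u ‖) t)))

    shift-by : Carrier → ℝ^ n
    shift-by s j = 1# * x j + s * u j

    u-shift : ∀ s → ⟨ u , shift-by s ⟩ ≈ ⟨ u , x ⟩ + s * uu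
    u-shift s = trans (dot-linearʳ u x u 1# s (λ _ → refl)) (+-congʳ (*-identityˡ ⟨ u , x ⟩))

    near : ∀ s → (∀ q → s * s * q ≈ t * t * q) → shift-by s ∈ Ball x ε
    near s s²≈t² = ≰⇒< λ ε≤ → <⇒≰ t*‖u‖<ε (≤-trans ε≤
      (norm-scale-≤ u (shift-by s ⊖ x) (proj₁ 0<t) (trans
        (dot-scale² u {shift-by s ⊖ x} s (λ k →
          solve 3 (λ x s u → (:1 :* x :+ s :* u) :- x := s :* u) refl (x k) s (u k)))
        (s²≈t² uu))))

-- Cutting an interval into gaps

module Gaps (em : ExcludedMiddle 0ℓ) (ℝ : CompleteOrderedField)
  (V : Pred (CompleteOrderedField.Carrier ℝ) 0ℓ) where

  open CompleteOrderedField ℝ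
  open FieldProperties ℝ
  open DifferenceSolver commutativeRing
  open OrderedField em ℝ

  -- Later `V` holds the values of `⟨ u , _ ⟩` on `M`, and `cs` covers the values at the given
  -- points, so each gap gives an admissible plank. Gaps of length zero are allowed because cuts may
  -- coincide with each other or with an end of the interval.
  record Gap (cs : List Carrier) (p q : Carrier) : Set where
    constructor gap
    field
      p≤q    : p ≤ q
      p∈V    : p ∈ V
      q∈V    : q ∈ V
      avoids : All (λ c → c ≤ p ⊎ q ≤ c) cs

  data Chain (cs : List Carrier) : ℕ → Carrier → Carrier → Set where
    [_]  : ∀ {p q} → Gap cs p q → Chain cs 1 p q
    _∷_  : ∀ {k p q r} → Gap cs p q → Chain cs k q r → Chain cs (suc k) p r

  avoid : ∀ {c cs p q} → c ≤ p ⊎ q ≤ c → Gap cs p q → Gap (c ∷ cs) p q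
  avoid out (gap p≤q p∈V q∈V avoids) = gap p≤q p∈V q∈V (out ∷ avoids)

  avoid-all : ∀ {c cs k p q} → c ≤ p → Chain cs k p q → Chain (c ∷ cs) k p q
  avoid-all c≤p [ g ]    = [ avoid (inj₁ c≤p) g ]
  avoid-all c≤p (g ∷ gs) =
    avoid (inj₁ c≤p) g ∷ avoid-all (≤-trans c≤p (Gap.p≤q g)) gs

  splitˡ : ∀ {c cs p q} → c ∈ V → p ≤ c → c ≤ q → Gap cs p q → Gap (c ∷ cs) p c
  splitˡ c∈V p≤c c≤q (gap _ p∈V _ avoids) =
    gap p≤c p∈V c∈V (inj₂ ≤-refl ∷ All.map (Sum.map₂ (≤-trans c≤q)) avoids)

  splitʳ : ∀ {c cs p q} → c ∈ V → p ≤ c → c ≤ q → Gap cs p q → Gap (c ∷ cs) c q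
  splitʳ c∈V p≤c c≤q (gap _ _ q∈V avoids) =
    gap c≤q c∈V q∈V (inj₁ ≤-refl ∷ All.map (Sum.map₁ (λ d≤p → ≤-trans d≤p p≤c)) avoids)

  -- One gap is split, so the count grows by one; the gaps before it end at or before `c`, and those
  -- after it begin at or after `c`.
  insert : ∀ {c cs k p q} → c ∈ V → p ≤ c → c ≤ q → Chain cs k p q →
           Chain (c ∷ cs) (suc k) p q
  insert c∈V p≤c c≤q [ g ] = splitˡ c∈V p≤c c≤q g ∷ [ splitʳ c∈V p≤c c≤q g ]
  insert {c} c∈V p≤c c≤q (_∷_ {q = r} g gs) with total c r
  ... | inj₁ c≤r = splitˡ c∈V p≤c c≤r g ∷ splitʳ c∈V p≤c c≤r g ∷ avoid-all c≤r gs
  ... | inj₂ r≤c = avoid (inj₂ r≤c) g ∷ insert c∈V r≤c c≤q gs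

  -- Cuts enter the single gap from `p` to `q` one at a time, in any order, and each adds one gap.
  chain : ∀ {p q} → p ≤ q → p ∈ V → q ∈ V → ∀ {cs} →
          All (λ c → c ∈ V × p ≤ c × c ≤ q) cs → Chain cs (suc (length cs)) p q
  chain p≤q p∈V q∈V []                        = [ gap p≤q p∈V q∈V [] ]
  chain p≤q p∈V q∈V ((c∈V , p≤c , c≤q) ∷ cs) =
    insert c∈V p≤c c≤q (chain p≤q p∈V q∈V cs)

  -- A chain is never empty; this later supplies the admissible width that `supremum` demands.
  head : ∀ {cs k p q} → Chain cs k p q → ∃₂ (Gap cs)
  head [ g ]   = _ , _ , g
  head (g ∷ _) = _ , _ , g

  -- The lengths of consecutive gaps telescope to `q - p`.
  chain-length-≤ : ∀ {cs s G} → (∀ {p q} → Gap cs p q → (q - p) * s ≤ G) →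
                   ∀ {k p q} → Chain cs k p q → (q - p) * s ≤ (k ·ℕ 1#) * G
  chain-length-≤ {G = G} gap-≤ [ g ] = ≤-respʳ
    (solve 1 (λ G → G := (:1 :+ :0) :* G) refl G) (gap-≤ g)
  chain-length-≤ {s = s} {G} gap-≤ (_∷_ {k} {p} {q} {r} g gs) = ≤-respˡ
    (solve 4 (λ p q r s → (q :- p) :* s :+ (r :- q) :* s := (r :- p) :* s) refl p q r s)
    (≤-respʳ (solve 2 (λ k G → G :+ k :* G := (:1 :+ k) :* G) refl (k ·ℕ 1#) G)
      (+-mono-≤ (gap-≤ g) (chain-length-≤ gap-≤ gs)))

-- Admissible planks from gaps

module Planks (em : ExcludedMiddle 0ℓ) (ℝ : CompleteOrderedField)
  {n k} (M : Geometry.Subset ℝ (suc n))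
  (M-sat : Satisfiable M) (M-compact : Geometry.Compact ℝ M)
  (x : Vector (Geometry.ℝ^ ℝ (suc n)) k) (x∈M : ∀ i → x i ∈ M) where

  open CompleteOrderedField ℝ
  open FieldProperties ℝ
  open Geometry ℝ
  open DifferenceSolver commutativeRing
  open OrderedField em ℝ
  open EuclideanSpace em ℝ

  -- There are at most `n` differences from the first point `y`, so in dimension `suc n` some
  -- nonzero `u` is orthogonal to all of them. Without points, `c` is the value at some point of
  -- `M`, so that `c` can always serve as a cut.
  hyperplane-through : ∀ ys → length ys ℕ.≤ suc n → All (_∈ M) ys →
    ∃ λ u → u ∉ IsZero × ∃ λ c → Hyperplane u c ≬ M × All (_∈ Hyperplane u c) ys
  hyperplane-through [] _ _ =
    let u , u≉0 , _ = normal-vector n [] ℕ.z≤n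
        a , a∈M     = M-sat
    in u , u≉0 , ⟨ u , a ⟩ , (a , refl , a∈M) , []
  hyperplane-through (y ∷ ys) (ℕ.s≤s ∣ys∣≤n) (y∈M ∷ _) =
    let u , u≉0 , u⊥ = normal-vector n (List.map (_⊖ y) ys)
          (≡.subst (ℕ._≤ n) (≡.sym (length-map (_⊖ y) ys)) ∣ys∣≤n)
    in u , u≉0 , ⟨ u , y ⟩ , (y , refl , y∈M) , refl ∷ All.map
         (λ {z} u⊥z-y → ≈-by 1# (trans (sym (dot-⊖ u z y)) u⊥z-y)
           (solve 2 (λ a b → a := b :+ ((a :- b) :- :0) :* :1) refl ⟨ u , z ⟩ ⟨ u , y ⟩))
         (map⁻ u⊥)

  module _ {u : ℝ^ (suc n)} (u≉0 : u ∉ IsZero) where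

    open Strip em ℝ u≉0
    open Gaps em ℝ (λ c → Hyperplane u c ≬ M)

    -- A given point in the interior would have its value strictly between `p` and `q`, yet `covers`
    -- makes that value one of the cuts that the gap avoids.
    gap-width : ∀ {cs} → (∀ i → Any (⟨ u , x i ⟩ ≈_) cs) → ∀ {p q} → Gap cs p q →
                (q - p) * scale ∈ AdmissibleWidth M x
    gap-width covers (gap p≤q p-meets q-meets avoids) =
      strip p≤q , ((p-meets , q-meets) , λ i xᵢ∈interior →
        let p<uxᵢ , uxᵢ<q = interior⇒strictly-between p≤q {x i} xᵢ∈interior
        in All.lookupWith (λ where
             (inj₁ c≤p) uxᵢ≈c → <⇒≰ p<uxᵢ (≤-respˡ (sym uxᵢ≈c) c≤p)
             (inj₂ q≤c) uxᵢ≈c → <⇒≰ uxᵢ<q (≤-respʳ (sym uxᵢ≈c) q≤c))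
           avoids (covers i)) , strip-width p≤q

  -- The width of a plank is at most the distance between points of `M` on its two bounding
  -- hyperplanes.
  admissible-bounded : Satisfiable (UpperBound (AdmissibleWidth M x))
  admissible-bounded =
    let D , ≤D = compact-diameter M-sat M-compact
    in D , λ (P , (((a , a∈l , a∈M) , (b , b∈u , b∈M)) , _) , d-lower , _) →
      ≤-trans (d-lower (a , b , a∈l , b∈u , refl)) (≤D a∈M b∈M)

  -- The first `suc n` points share one cut and each remaining point adds one. The estimate is for
  -- every upper bound `H`, since the supremum can be formed only once the first component is known.
  width-≤-sum : ∀ {w} → IsWidth M w →
    Satisfiable (AdmissibleWidth M x) ×
    (∀ {H} → H ∈ UpperBound (AdmissibleWidth M x) →
      w ≤ ((2 ℕ.+ (k ℕ.∸ suc n)) ·ℕ 1#) * H)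
  width-≤-sum {w} (_ , w-minimal) =
      (let _ , _ , g = head gaps in _ , gap-width u≉0 covers g) ,
      λ {H} ≤H → ≤-trans
        (w-minimal (strip a≤b , (((a , refl , a∈M) , (b , refl , b∈M)) ,
          λ y∈M → a-min y∈M , b-max y∈M) , strip-width a≤b))
        (≡.subst (λ m → (⟨ u , b ⟩ - ⟨ u , a ⟩) * scale ≤ (m ·ℕ 1#) * H) (≡.cong (2 ℕ.+_) ∣rest∣)
          (chain-length-≤ (λ g → ≤H (gap-width u≉0 covers g)) gaps))
    where
    xs = List.tabulate x
    xs⊆M : All (_∈ M) xs
    xs⊆M = tabulate⁺ x∈M

    through = hyperplane-through (List.take (suc n) xs)
      (≡.subst (ℕ._≤ suc n) (≡.sym (length-take (suc n) xs)) (ℕ.m⊓n≤m (suc n) (length xs)))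
      (take⁺ (suc n) xs⊆M)
    u = proj₁ through
    u≉0 = proj₁ (proj₂ through)
    c = proj₁ (proj₂ (proj₂ through))
    c-meets = proj₁ (proj₂ (proj₂ (proj₂ through)))
    first∈ = proj₂ (proj₂ (proj₂ (proj₂ through)))

    open Strip em ℝ u≉0
    open Gaps em ℝ (λ c → Hyperplane u c ≬ M)

    rest = List.map ⟨ u ,_⟩ (List.drop (suc n) xs)

    ∣rest∣ : length rest ≡ k ℕ.∸ suc n
    ∣rest∣ = ≡.trans (length-map ⟨ u ,_⟩ (List.drop (suc n) xs))
      (≡.trans (length-drop (suc n) xs) (≡.cong (ℕ._∸ suc n) (length-tabulate x)))

    covers : ∀ i → Any (⟨ u , x i ⟩ ≈_) (c ∷ rest)
    covers = tabulate⁻ (≡.subst (All (λ y → Any (⟨ u , y ⟩ ≈_) (c ∷ rest)))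
      (take++drop≡id (suc n) xs)
      (All.++⁺ (All.map here first∈)
        (All.tabulate λ y∈ → there (Any.map⁺
          (Any.map (λ y≡z → reflexive (≡.cong ⟨ u ,_⟩ y≡z)) y∈)))))

    minimum = attains-minimum M-sat M-compact u
    maximum = attains-maximum M-sat M-compact u
    a = proj₁ minimum
    b = proj₁ maximum
    a∈M = proj₁ (proj₂ minimum)
    b∈M = proj₁ (proj₂ maximum)
    a-min : ∀ {y} → y ∈ M → ⟨ u , a ⟩ ≤ ⟨ u , y ⟩
    a-min = proj₂ (proj₂ minimum)
    b-max : ∀ {y} → y ∈ M → ⟨ u , y ⟩ ≤ ⟨ u , b ⟩
    b-max = proj₂ (proj₂ maximum)
    a≤b = a-min b∈M

    in-range : ∀ {c} → Hyperplane u c ≬ M →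
               (Hyperplane u c ≬ M) × ⟨ u , a ⟩ ≤ c × c ≤ ⟨ u , b ⟩
    in-range c-meets@(y , uy≈c , y∈M) =
      c-meets , ≤-respʳ uy≈c (a-min y∈M) , ≤-respˡ uy≈c (b-max y∈M)

    -- The cut `c` adds one to the length of `rest`, and there is one gap more than there are cuts.
    gaps : Chain (c ∷ rest) (2 ℕ.+ length rest) ⟨ u , a ⟩ ⟨ u , b ⟩
    gaps = chain a≤b (a , refl , a∈M) (b , refl , b∈M)
      (in-range c-meets ∷ All.map⁺ (All.map (λ {y} y∈M → in-range (y , refl , y∈M))
        (drop⁺ (suc n) xs⊆M)))

proposition4p1 :
    ExcludedMiddle 0ℓ →
    (ℝ : CompleteOrderedField) →
    let open CompleteOrderedField ℝ
        open FieldProperties ℝ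
        open Geometry ℝ
    in
    (n k : ℕ) (M : Subset n) →
    Satisfiable M → Compact M → Convex M →
    (w : Carrier) → IsWidth M w →
    (x : Vector (ℝ^ n) k) → (∀ i → x i ∈ M) →
    ∃ λ H → IsSupremum (AdmissibleWidth M x) H
          × (n ℕ.≤ k → w / (2 ℕ.+ (k ℕ.∸ n)) ≤ H)
          × (k ℕ.< n → w / 2 ≤ H)
-- In dimension zero every vector is vacuously zero, so the plank realising the width cannot have
-- its normal.
proposition4p1 em ℝ zero k M _ _ _ w ((P , _) , _) x _ =
  contradiction (λ ()) (Geometry.Plank.normal≉0 P)
proposition4p1 em ℝ (suc n) k M M-sat M-compact _ w w-width x x∈M =
  let admissible , w≤sum = width-≤-sum w-width
      H , H-sup = supremum (AdmissibleWidth M x) admissible admissible-bounded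
      bound : w / (2 ℕ.+ (k ℕ.∸ suc n)) ≤ H
      bound = /-≤ (suc (k ℕ.∸ suc n)) (w≤sum (proj₁ H-sup))
  in H , H-sup , (λ _ → bound) ,
     -- Both cases are the same bound: for `k < suc n` truncated subtraction gives 0, and the
     -- denominator becomes 2.
     λ k<n → ≡.subst (λ m → w / (2 ℕ.+ m) ≤ H) (ℕ.m≤n⇒m∸n≡0 (ℕ.<⇒≤ k<n)) bound
  where
  open CompleteOrderedField ℝ
  open FieldProperties ℝ
  open Geometry ℝ
  open OrderedField em ℝ
  open Planks em ℝ M M-sat M-compact x x∈M
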